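{- Let $f:(X,\kappa)\to(Y,\lambda)$ be a digital isomorphism between digital images. Then $f$ is universal for $(X,Y)$ if and only if $(X,\kappa)$ has the approximate fixed point property (AFPP).
   Context: A digital image is a pair $(X,\kappa)$ where $\emptyset\neq X\subset\mathbf{Z}^n$ for some positive integer $n$ and $\kappa$ is an adjacency relation on $X$ (a symmetric, irreflexive relation, so that $(X,\kappa)$ is an undirected simple graph with vertex set $X$). Write $a\leftrightarrow_\kappa b$ if $a=b$ or $a,b$ are $\kappa$-adjacent. A subset $A\subset X$ is $\kappa$-connected if for every two distinct points $x,y\in A$ there are $x=x_0,\ldots,x_c=y$ in $A$ with consecutive points $\kappa$-adjacent. A function $f:(X,\kappa)\to(Y,\lambda)$ between digital images is $(\kappa,\lambda)$-continuous if $f(A)$ is $\lambda$-connected for every $\kappa$-connected $A\subset X$; equivalently, whenever $x_0,x_1\in X$ are $\kappa$-adjacent, $f(x_0)\leftrightarrow_\lambda f(x_1)$. A digital isomorphism (or $(\kappa,\lambda)$-isomorphism) is a $(\kappa,\lambda)$-continuous bijection $h:X\to Y$ whose inverse is $(\lambda,\kappa)$-continuous. The digital image $(X,\kappa)$ has the approximate fixed point property (AFPP) if every $(\kappa,\kappa)$-continuous $f:X\to X$ has a point $p\in X$ with $f(p)\leftrightarrow_\kappa p$. A $(\kappa,\lambda)$-continuous function $f:X\to Y$ is universal for $(X,Y)$ if for every $(\kappa,\lambda)$-continuous function $g:X\to Y$ there exists $x\in X$ such that $f(x)\leftrightarrow_\lambda g(x)$. -}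

module Defs where

open import Data.Fin.Base using (Fin; zero; suc; inject₁; fromℕ)
open import Data.Integer.Base using (ℤ)
open import Data.Nat.Base using (ℕ; suc; NonZero)
open import Data.Product.Base using (∃-syntax; Σ-syntax; _×_; proj₁; proj₂)
open import Data.Refinement.Base using (Refinement-syntax)
open import Data.Vec.Base using (Vec)
open import Function.Base using (_∘_)
open import Function.Definitions using (Bijective)
open import Level using (0ℓ)
open import Relation.Binary.Construct.Closure.Reflexive using (ReflClosure)
open import Relation.Binary.Core using (Rel)
open import Relation.Binary.Definitions using (Irreflexive; Symmetric)
open import Relation.Binary.PropositionalEquality.Core using (_≡_; _≢_)
open import Relation.Unary using (Pred; Satisfiable)

record DigitalImage : Set₁ where
  field
    dim         : ℕ
    dim-nonZero : NonZero dim
    X           : Pred (Vec ℤ dim) 0ℓ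
    nonempty    : Satisfiable X

  -- The membership proof stored in a point is irrelevant, so two points are
  -- propositionally equal as soon as their coordinate vectors are.
  Point : Set
  Point = [ v ∈ Vec ℤ dim ∣ X v ]

  field
    Adjacent   : Rel Point 0ℓ
    adj-sym    : Symmetric Adjacent
    adj-irrefl : Irreflexive _≡_ Adjacent

  infix 4 _↔_
  _↔_ : Rel Point 0ℓ
  _↔_ = ReflClosure Adjacent

  Connected : Pred Point 0ℓ → Set
  Connected A = ∀ x y → A x → A y → x ≢ y →
    ∃[ c ] Σ[ p ∈ (Fin (suc c) → Point) ]
      p zero ≡ x × p (fromℕ c) ≡ y ×
      (∀ i → A (p i)) ×
      (∀ (i : Fin c) → Adjacent (p (inject₁ i)) (p (suc i)))

open DigitalImage public using (Point)

image : {A B : Set} → (A → B) → Pred A 0ℓ → Pred B 0ℓ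
image f P y = ∃[ x ] P x × f x ≡ y

module _ (X Y : DigitalImage) where

  private
    module X = DigitalImage X
    module Y = DigitalImage Y

  Continuous : (Point X → Point Y) → Set₁
  Continuous f = ∀ (A : Pred (Point X) 0ℓ) → X.Connected A → Y.Connected (image f A)

  record Universal (f : Point X → Point Y) : Set₁ where
    field
      continuous : Continuous f
      universal  : ∀ (g : Point X → Point Y) → Continuous g → ∃[ x ] f x Y.↔ g x

AFPP : DigitalImage → Set₁
AFPP X = ∀ (f : Point X → Point X) → Continuous X X f → ∃[ p ] f p ↔ p
  where open DigitalImage X using (_↔_)

record IsIsomorphism (X Y : DigitalImage) (f : Point X → Point Y) : Set₁ where
  field
    continuous : Continuous X Y f
    bijective  : Bijective _≡_ _≡_ f

  inverse : Point Y → Point X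
  inverse = proj₁ ∘ proj₂ bijective

  field
    inverse-continuous : Continuous Y X inverse

{-# OPTIONS --safe #-}

-- Continuity preserves _↔_: a pair of adjacent points is a connected set, and
-- a walk inside the pair of their images must somewhere cross from one to the
-- other.  Hence composing with f or with its inverse turns self-maps h of X
-- into maps g : X → Y and back, matching h p ↔ p with f p ↔ g p.

module Submission where

open import Defs
open import Data.Fin.Base using (Fin; zero; suc; inject₁; fromℕ)
import Data.Integer.Properties as ℤ
open import Data.Nat.Base using (zero; suc)
open import Data.Product.Base using (_,_; ∃-syntax; proj₁; proj₂)
import Data.Refinement.Properties as Refinement
open import Data.Sum.Base using (inj₁; inj₂)
import Data.Vec.Properties as Vec
open import Function.Base using (_∘_)
open import Function.Bundles using (_⇔_; mk⇔)
open import Level using (0ℓ)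
open import Relation.Binary.Construct.Closure.Reflexive using (ReflClosure; [_]; refl; reflexive)
import Relation.Binary.Construct.Closure.Reflexive.Properties as Refl
open import Relation.Binary.Core using (Rel)
open import Relation.Binary.Definitions using (DecidableEquality)
open import Relation.Binary.PropositionalEquality
  using (_≡_; refl; sym; trans; subst; subst₂)
open import Relation.Nullary.Decidable.Core using (yes; no)
open import Relation.Nullary.Negation.Core using (contradiction)
open import Relation.Unary using (Pred; _∈_; _∪_; _≐_; ｛_｝)

module _ (X : DigitalImage) where

  open DigitalImage X using (Adjacent; Connected; adj-sym)

  point-≟ : DecidableEquality (Point X)
  point-≟ = Refinement._≟_ (Vec.≡-dec ℤ._≟_)

  adjacent⇒pair-connected : ∀ {a b} → Adjacent a b → Connected (｛ a ｝ ∪ ｛ b ｝)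
  adjacent⇒pair-connected _ x y (inj₁ refl) (inj₁ refl) x≢y = contradiction refl x≢y
  adjacent⇒pair-connected _ x y (inj₂ refl) (inj₂ refl) x≢y = contradiction refl x≢y
  adjacent⇒pair-connected {a} {b} a~b x y (inj₁ refl) (inj₂ refl) _ =
    1 , (λ { zero → a ; (suc zero) → b }) , refl , refl ,
    (λ { zero → inj₁ refl ; (suc zero) → inj₂ refl }) , λ { zero → a~b }
  adjacent⇒pair-connected {a} {b} a~b x y (inj₂ refl) (inj₁ refl) _ =
    1 , (λ { zero → b ; (suc zero) → a }) , refl , refl ,
    (λ { zero → inj₂ refl ; (suc zero) → inj₁ refl }) , λ { zero → adj-sym a~b }

  -- Needed for composites: the image under `g ∘ f` and the image under `g` of an image under `f`
  -- have the same elements but are different predicates.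
  Connected-resp-≐ : {A B : Pred (Point X) 0ℓ} → A ≐ B → Connected A → Connected B
  Connected-resp-≐ (A⊆B , B⊆A) connected x y x∈B y∈B x≢y
    with c , p , p₀≡x , pc≡y , p∈A , step ← connected x y (B⊆A x∈B) (B⊆A y∈B) x≢y
    = c , p , p₀≡x , pc≡y , (λ i → A⊆B (p∈A i)) , step

-- Induction on the length of the walk. With no steps the endpoints coincide. Otherwise look at the
-- second point: if it is `a`, drop the first step and recurse; if it is `b`, the first step is
-- itself the wanted relation from `a` to `b`.
walk-in-pair : ∀ {A : Set} {_~_ : Rel A 0ℓ} {a b : A} c (p : Fin (suc c) → A) →
  p zero ≡ a → p (fromℕ c) ≡ b → (∀ i → p i ∈ ｛ a ｝ ∪ ｛ b ｝) →
  (∀ (i : Fin c) → p (inject₁ i) ~ p (suc i)) → ReflClosure _~_ a b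
walk-in-pair zero p p₀≡a p₀≡b _ _ = reflexive (trans (sym p₀≡a) p₀≡b)
walk-in-pair {_~_ = _~_} (suc c) p p₀≡a pc≡b p∈ step with p∈ (suc zero)
... | inj₁ a≡p₁ = walk-in-pair c (p ∘ suc) (sym a≡p₁) pc≡b (p∈ ∘ suc) (step ∘ suc)
... | inj₂ b≡p₁ = [ subst₂ _~_ p₀≡a (sym b≡p₁) (step zero) ]

module _ {X Y : DigitalImage} {f : Point X → Point Y} where

  private
    module X = DigitalImage X
    module Y = DigitalImage Y

  continuous⇒↔-preserving : Continuous X Y f → ∀ {a b} → a X.↔ b → f a Y.↔ f b
  continuous⇒↔-preserving _ refl = refl
  -- Connectedness yields walks only between distinct points, so the case of equal images is split
  -- off; there reflexivity suffices.
  continuous⇒↔-preserving cont {a} {b} [ a~b ] with point-≟ Y (f a) (f b)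
  ... | yes fa≡fb = reflexive fa≡fb
  ... | no fa≢fb
    with c , p , p₀≡fa , pc≡fb , p∈ , step ←
      cont (｛ a ｝ ∪ ｛ b ｝) (adjacent⇒pair-connected X a~b) (f a) (f b)
        (a , inj₁ refl , refl) (b , inj₂ refl , refl) fa≢fb
    = walk-in-pair c p p₀≡fa pc≡fb (image-pair ∘ p∈) step
    where
    image-pair : ∀ {y} → image f (｛ a ｝ ∪ ｛ b ｝) y → y ∈ ｛ f a ｝ ∪ ｛ f b ｝
    image-pair (_ , inj₁ refl , fa≡y) = inj₁ fa≡y
    image-pair (_ , inj₂ refl , fb≡y) = inj₂ fb≡y

continuous-∘ : ∀ {X Y Z} {g : Point Y → Point Z} {f : Point X → Point Y} →
  Continuous Y Z g → Continuous X Y f → Continuous X Z (g ∘ f)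
continuous-∘ {Z = Z} {g} {f} g-cont f-cont A A-connected =
  Connected-resp-≐ Z
    ( (λ { (_ , (x , x∈A , refl) , gfx≡z) → x , x∈A , gfx≡z })
    , (λ { (x , x∈A , gfx≡z) → f x , (x , x∈A , refl) , gfx≡z }))
    (g-cont (image f A) (f-cont A A-connected))

corollary6p9 : (X Y : DigitalImage) (f : Point X → Point Y) → IsIsomorphism X Y f →
    Universal X Y f ⇔ AFPP X
corollary6p9 X Y f iso = mk⇔ universal⇒AFPP AFPP⇒universal
  where
  module X = DigitalImage X
  module Y = DigitalImage Y
  open IsIsomorphism iso renaming (inverse to f⁻¹)

  f∘f⁻¹ : ∀ y → f (f⁻¹ y) ≡ y
  f∘f⁻¹ y = proj₂ (proj₂ bijective y) refl

  f⁻¹∘f : ∀ x → f⁻¹ (f x) ≡ x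
  f⁻¹∘f x = proj₁ bijective (f∘f⁻¹ (f x))

  universal⇒AFPP : Universal X Y f → AFPP X
  universal⇒AFPP f-universal h h-cont
    with p , fp↔fhp ← Universal.universal f-universal (f ∘ h) (continuous-∘ {X} {X} {Y} continuous h-cont)
    = p , Refl.sym X.adj-sym (subst₂ X._↔_ (f⁻¹∘f p) (f⁻¹∘f (h p))
            (continuous⇒↔-preserving {Y} {X} inverse-continuous fp↔fhp))

  AFPP⇒universal : AFPP X → Universal X Y f
  AFPP⇒universal afpp = record { continuous = continuous ; universal = universal }
    where
    universal : ∀ g → Continuous X Y g → ∃[ x ] f x Y.↔ g x
    universal g g-cont
      -- The self-map `f⁻¹ ∘ g` is chosen so that `f` sends its value at `p` back to `g p`. An
      -- approximate fixed point `p` thus gives `g p ↔ f p`, and symmetry turns this round.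
      with p , f⁻¹gp↔p ← afpp (f⁻¹ ∘ g) (continuous-∘ {X} {Y} {X} inverse-continuous g-cont)
      = p , Refl.sym Y.adj-sym (subst (Y._↔ f p) (f∘f⁻¹ (g p))
              (continuous⇒↔-preserving {X} {Y} continuous f⁻¹gp↔p))
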